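{- For every signature $\Sigma$, the data $\mathcal F_\Sigma$ described below form a category with families. Moreover, if the variable system has the de Bruijn property, then $\mathcal F_\Sigma$ is a contextual category with families.
   Context: Fix an infinite set $V$ of variables with decidable equality, and a fresh variable provider: functions $\varphi,\mathsf{fr}$ assigning to each finite $X\subseteq V$ an inhabited subset $\varphi(X)\subseteq V\setminus X$ and an element $\mathsf{fr}(X)\in\varphi(X)$. The variable system has the de Bruijn property if $\varphi(X)=\{\mathsf{fr}(X)\}$ for all finite $X$. Fix disjoint sets $F$ (function symbols) and $T$ (type symbols) with decidable equality. Preelements are terms built from variables and symbols of $F$; a pretype is $S(t_1,\ldots,t_n)$ with $S\in T$ and $t_i$ preelements. $\mathrm{V}(E)$ is the set of variables of an expression $E$, $\equiv$ is syntactic identity, and $E[\bar a/\bar x]$ is simultaneous substitution. A precontext is a sequence $\Gamma=x_1:A_1,\ldots,x_n:A_n$ of pretypes with $x_k\in\varphi(\{x_1,\ldots,x_{k-1}\})$ and $\mathrm{V}(A_k)\subseteq\{x_1,\ldots,x_{k-1}\}$; $\mathrm{OV}(\Gamma)=x_1,\ldots,x_n$, $\mathrm{V}(\Gamma)=\{x_1,\ldots,x_n\}$, $\mathrm{Fresh}(\Gamma)=\varphi(\mathrm{V}(\Gamma))$, $\mathrm{fresh}(\Gamma)=\mathsf{fr}(\mathrm{V}(\Gamma))$, $E[\bar a/\Gamma]=E[\bar a/x_1,\ldots,x_n]$. Top variables: $\mathrm{TV}(\langle\rangle)=\emptyset$, $\mathrm{TV}(\Gamma,x:A)=(\mathrm{TV}(\Gamma)\setminus\mathrm{V}(A))\cup\{x\}$.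 A determining sequence for $\Gamma$ is a strictly increasing $\bar i=i_1,\ldots,i_k$ in $\{1,\ldots,n\}$ with $\mathrm{TV}(\Gamma)\subseteq\{x_{i_1},\ldots,x_{i_k}\}$; for $\bar a=a_1,\ldots,a_n$ put $\bar a_{\bar i}=a_{i_1},\ldots,a_{i_k}$. A type predeclaration is $(\Gamma,S,\bar i)$ with $S\in T$, $\bar i$ determining; a function predeclaration is $(\Gamma,f,\bar i,U)$ with $f\in F$, $\bar i$ determining, $U$ a pretype with $\mathrm{V}(U)\subseteq\mathrm{V}(\Gamma)$. A presignature is a set $\Sigma$ of predeclarations with no symbol declared twice. Judgements are "$\Gamma$ context", "$A$ type $(\Gamma)$", "$a:A\ (\Gamma)$". $\mathcal{J}(\Sigma)$ is the smallest set of judgements closed under: (R1) $\langle\rangle$ context; (R2) from $\Gamma$ context and $A$ type $(\Gamma)$ infer $\Gamma,x:A$ context, for $x\in\mathrm{Fresh}(\Gamma)$; (R3) from $x_1:A_1,\ldots,x_n:A_n$ context infer $x_i:A_i\ (x_1:A_1,\ldots,x_n:A_n)$; (R4) if $(\Gamma,S,\bar i)\in\Sigma$ and $\bar a:\Delta\to\Gamma$, infer $S(\bar a_{\bar i})$ type $(\Delta)$; (R5) if $(\Gamma,f,\bar i,U)\in\Sigma$, $\bar a:\Delta\to\Gamma$ and $U[\bar a/\Gamma]$ type $(\Delta)$, infer $f(\bar a_{\bar i}):U[\bar a/\Gamma]\ (\Delta)$. Here, for $\Gamma=x_1:A_1,\ldots,x_n:A_n$, the context map "$\bar a:\Delta\to\Gamma$"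 abbreviates the $n+2$ judgements $\Delta$ context, $\Gamma$ context, and $a_k:A_k[a_1,\ldots,a_{k-1}/x_1,\ldots,x_{k-1}]\ (\Delta)$ for $k=1,\ldots,n$. $\Sigma$ is a signature if ($\Gamma$ context)$\in\mathcal{J}(\Sigma)$ whenever $(\Gamma,S,\bar i)\in\Sigma$, and ($U$ type $(\Gamma)$)$\in\mathcal{J}(\Sigma)$ whenever $(\Gamma,f,\bar i,U)\in\Sigma$. A category with families (cwf) consists of: a category $\mathcal C$ with a terminal object $\top$; for each object $\Gamma$ a class $\mathrm{Ty}(\Gamma)$, and for $f:\Delta\to\Gamma$ a function $A\mapsto A\{f\}:\mathrm{Ty}(\Gamma)\to\mathrm{Ty}(\Delta)$ with $A\{1\}=A$, $A\{f\circ g\}=A\{f\}\{g\}$; for $A\in\mathrm{Ty}(\Gamma)$ an object $\Gamma.A$ and a morphism $\mathrm{p}(A)=\mathrm{p}_\Gamma(A):\Gamma.A\to\Gamma$; for $A\in\mathrm{Ty}(\Gamma)$ a class $\mathrm{Tm}(\Gamma,A)$ and for $f:\Delta\to\Gamma$ a function $a\mapsto a\{f\}:\mathrm{Tm}(\Gamma,A)\to\mathrm{Tm}(\Delta,A\{f\})$ with $a\{1\}=a$, $a\{f\circ g\}=a\{f\}\{g\}$; for each $A\in\mathrm{Ty}(\Gamma)$ an element $\mathrm{v}_A\in\mathrm{Tm}(\Gamma.A,A\{\mathrm{p}(A)\})$; for $f:\Delta\to\Gamma$ and $a\in\mathrm{Tm}(\Delta,A\{f\})$ a morphism $\langle f,a\rangle_A:\Delta\to\Gamma.A$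 such that $\mathrm{p}(A)\circ\langle f,a\rangle_A=f$, $\mathrm{v}_A\{\langle f,a\rangle_A\}=a$, $\langle\mathrm{p}(A)\circ h,\mathrm{v}_A\{h\}\rangle_A=h$ for every $h:\Delta\to\Gamma.A$, and $\langle f,a\rangle_A\circ g=\langle f\circ g,a\{g\}\rangle_A$. A cwf is contextual if every object $\Gamma$ equals $\top.A_1.\cdots.A_n$ for a unique sequence $A_1\in\mathrm{Ty}(\top)$, $A_2\in\mathrm{Ty}(\top.A_1)$, $\ldots$, $A_n\in\mathrm{Ty}(\top.A_1.\cdots.A_{n-1})$, $n\ge 0$. The data $\mathcal F_\Sigma$: objects are precontexts $\Gamma$ with ($\Gamma$ context)$\in\mathcal{J}(\Sigma)$; morphisms $\Delta\to\Gamma$ are triples $(\Delta,\Gamma,\bar a)$ with $\bar a:\Delta\to\Gamma$ a context map in $\mathcal{J}(\Sigma)$; composition $(\Gamma,\Theta,\bar t)\circ(\Delta,\Gamma,\bar s)=(\Delta,\Theta,(t_1[\bar s/\Gamma],\ldots,t_k[\bar s/\Gamma]))$; identity $(\Gamma,\Gamma,\mathrm{OV}(\Gamma))$; terminal object the empty context $\langle\rangle$. $\mathrm{Ty}(\Gamma)=\{(\Gamma,A): (A\text{ type }(\Gamma))\in\mathcal{J}(\Sigma)\}$ with $(\Gamma,A)\{(\Delta,\Gamma,\bar a)\}=(\Delta,A[\bar a/\Gamma])$; $\mathrm{Tm}(\Gamma,(\Gamma,A))=\{((\Gamma,A),a): (a:A\ (\Gamma))\in\mathcal{J}(\Sigma)\}$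 with $((\Gamma,A),a)\{(\Delta,\Gamma,\bar a)\}=((\Delta,A[\bar a/\Gamma]),a[\bar a/\Gamma])$. For $\mathrm S=(\Gamma,S)\in\mathrm{Ty}(\Gamma)$: $\Gamma.\mathrm S=\langle\Gamma,\mathrm{fresh}(\Gamma):S\rangle$, $\mathrm{p}_\Gamma(\mathrm S)=(\Gamma.\mathrm S,\Gamma,\mathrm{OV}(\Gamma))$, $\mathrm{v}_{\mathrm S}=((\Gamma.\mathrm S,S),\mathrm{fresh}(\Gamma))$, and $\langle(\Delta,\Gamma,\bar s),((\Delta,S[\bar s/\Gamma]),b)\rangle_{\mathrm S}=(\Delta,\Gamma.\mathrm S,(\bar s,b))$. -}

module Defs where

open import Data.Fin.Base as Fin using (Fin)
open import Data.Irrelevant using ([_])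
open import Data.List.Base as List using (List; []; _∷_; _++_; filter)
open import Data.List.Membership.Propositional using (_∈_; _∉_)
import Data.List.Membership.DecPropositional as DecMembership
open import Data.List.Relation.Binary.BagAndSetEquality using (_∼[_]_; set)
open import Data.List.Relation.Binary.Subset.Propositional using (_⊆_)
open import Data.List.Relation.Unary.All using (All; []; _∷_)
open import Data.List.Relation.Unary.Linked using (Linked)
open import Data.Nat.Base using (ℕ; zero; suc)
open import Data.Product using (∃; ∃!; _×_; _,_)
open import Data.Refinement using (Refinement-syntax; _,_; value)
open import Data.Sum.Base using (_⊎_; inj₁; inj₂)
open import Data.Vec.Base as Vec using (Vec; []; _∷_; _∷ʳ_; init; last; lookup; toList)
open import Function.Bundles using (_↣_)
open import Level using (Level) renaming (suc to lsuc; _⊔_ to _⊔ˡ_)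
open import Relation.Binary.Definitions using (DecidableEquality)
open import Relation.Binary.PropositionalEquality
  using (_≡_; sym; trans; cong; subst)
open import Relation.Nullary.Decidable using (yes; no; ¬?)
open import Relation.Unary using (Pred; _≐_; ｛_｝)

------------------------------------------------------------------------
-- Categories with families

record CwfData (o h t m : Level) : Set (lsuc (o ⊔ˡ h ⊔ˡ t ⊔ˡ m)) where
  infixr 9 _∘_
  infixl 8 _⟪_⟫ _⟪_⟫ᵗ
  infixl 5 _▹_
  field
    Ob    : Set o
    Hom   : Ob → Ob → Set h
    id    : ∀ {Γ} → Hom Γ Γ
    _∘_   : ∀ {Θ Δ Γ} → Hom Δ Γ → Hom Θ Δ → Hom Θ Γ
    ⊤     : Ob
    Ty    : Ob → Set t
    _⟪_⟫  : ∀ {Δ Γ} → Ty Γ → Hom Δ Γ → Ty Δ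
    _▹_   : (Γ : Ob) → Ty Γ → Ob
    p     : ∀ {Γ} (A : Ty Γ) → Hom (Γ ▹ A) Γ
    Tm    : (Γ : Ob) → Ty Γ → Set m
    _⟪_⟫ᵗ : ∀ {Δ Γ A} → Tm Γ A → (f : Hom Δ Γ) → Tm Δ (A ⟪ f ⟫)
    v     : ∀ {Γ} (A : Ty Γ) → Tm (Γ ▹ A) (A ⟪ p A ⟫)
    pair  : ∀ {Δ Γ} (A : Ty Γ) (f : Hom Δ Γ) → Tm Δ (A ⟪ f ⟫) → Hom Δ (Γ ▹ A)

-- An equation between terms whose types are only provably equal is stated
-- after transport along the equality of types.
record IsCwf {o h t m} (𝒞 : CwfData o h t m) : Set (o ⊔ˡ h ⊔ˡ t ⊔ˡ m) where
  open CwfData 𝒞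
  field
    identityˡ : ∀ {Δ Γ} (f : Hom Δ Γ) → id ∘ f ≡ f
    identityʳ : ∀ {Δ Γ} (f : Hom Δ Γ) → f ∘ id ≡ f
    assoc     : ∀ {Ξ Θ Δ Γ} (f : Hom Δ Γ) (g : Hom Θ Δ) (h : Hom Ξ Θ) →
                (f ∘ g) ∘ h ≡ f ∘ (g ∘ h)
    terminal  : ∀ Γ → ∃ λ (f : Hom Γ ⊤) → ∀ (g : Hom Γ ⊤) → f ≡ g

    Ty-id : ∀ {Γ} (A : Ty Γ) → A ⟪ id ⟫ ≡ A
    Ty-∘  : ∀ {Θ Δ Γ} (A : Ty Γ) (f : Hom Δ Γ) (g : Hom Θ Δ) →
            A ⟪ f ∘ g ⟫ ≡ A ⟪ f ⟫ ⟪ g ⟫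
    Tm-id : ∀ {Γ} {A : Ty Γ} (a : Tm Γ A) →
            subst (Tm Γ) (Ty-id A) (a ⟪ id ⟫ᵗ) ≡ a
    Tm-∘  : ∀ {Θ Δ Γ} {A : Ty Γ} (a : Tm Γ A) (f : Hom Δ Γ) (g : Hom Θ Δ) →
            subst (Tm Θ) (Ty-∘ A f g) (a ⟪ f ∘ g ⟫ᵗ) ≡ a ⟪ f ⟫ᵗ ⟪ g ⟫ᵗ

    p-pair : ∀ {Δ Γ} (A : Ty Γ) (f : Hom Δ Γ) (a : Tm Δ (A ⟪ f ⟫)) →
             p A ∘ pair A f a ≡ f
    v-pair : ∀ {Δ Γ} (A : Ty Γ) (f : Hom Δ Γ) (a : Tm Δ (A ⟪ f ⟫)) →
             subst (Tm Δ)
                   (trans (sym (Ty-∘ A (p A) (pair A f a)))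
                          (cong (A ⟪_⟫) (p-pair A f a)))
                   (v A ⟪ pair A f a ⟫ᵗ)
             ≡ a
    pair-η : ∀ {Δ Γ} (A : Ty Γ) (h : Hom Δ (Γ ▹ A)) →
             pair A (p A ∘ h) (subst (Tm Δ) (sym (Ty-∘ A (p A) h)) (v A ⟪ h ⟫ᵗ))
             ≡ h
    pair-∘ : ∀ {Θ Δ Γ} (A : Ty Γ) (f : Hom Δ Γ) (a : Tm Δ (A ⟪ f ⟫))
             (g : Hom Θ Δ) →
             pair A f a ∘ g
             ≡ pair A (f ∘ g) (subst (Tm Θ) (sym (Ty-∘ A f g)) (a ⟪ g ⟫ᵗ))

module _ {o h t m} (𝒞 : CwfData o h t m) where
  open CwfData 𝒞

  -- Sequences A₁ ∈ Ty(⊤), A₂ ∈ Ty(⊤.A₁), …, with their object ⊤.A₁.⋯.Aₙ.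
  data TypeSequence : Set t
  object : TypeSequence → Ob

  data TypeSequence where
    ε    : TypeSequence
    _▸▸_ : (As : TypeSequence) → Ty (object As) → TypeSequence

  object ε         = ⊤
  object (As ▸▸ A) = object As ▹ A

  IsContextual : Set (o ⊔ˡ t)
  IsContextual = ∀ Γ → ∃! _≡_ (λ As → Γ ≡ object As)

------------------------------------------------------------------------
-- Variables and symbols

-- A finite subset of V is represented by a list of its elements. The
-- fields φ-cong and fr-cong say that φ and fr depend on the subset only.
record VariableSystem (ℓ : Level) : Set (lsuc ℓ) where
  infix 4 _≟_
  field
    V        : Set ℓ
    _≟_      : DecidableEquality V
    infinite : ℕ ↣ V
    φ        : List V → Pred V ℓ
    fr       : List V → V
    φ-cong   : ∀ {X Y} → X ∼[ set ] Y → φ X ≐ φ Y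
    fr-cong  : ∀ {X Y} → X ∼[ set ] Y → fr X ≡ fr Y
    φ-fresh  : ∀ {X x} → φ X x → x ∉ X
    fr∈φ     : ∀ X → φ X (fr X)

DeBruijn : ∀ {ℓ} → VariableSystem ℓ → Set ℓ
DeBruijn 𝕍 = ∀ X → φ X ≐ ｛ fr X ｝
  where open VariableSystem 𝕍

record Symbols (ℓ : Level) : Set (lsuc ℓ) where
  field
    F    : Set ℓ
    T    : Set ℓ
    _≟F_ : DecidableEquality F
    _≟T_ : DecidableEquality T

module Syntax {ℓ} (𝕍 : VariableSystem ℓ) (𝕊 : Symbols ℓ) where
  open VariableSystem 𝕍
  open Symbols 𝕊
  open DecMembership _≟_ using (_∈?_)

  data Preelement : Set ℓ where
    var : V → Preelement
    fun : F → List Preelement → Preelement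

  data Pretype : Set ℓ where
    ty : T → List Preelement → Pretype

  varsᵉ  : Preelement → List V
  varsᵉˢ : List Preelement → List V
  varsᵉ (var x)    = x ∷ []
  varsᵉ (fun f ts) = varsᵉˢ ts
  varsᵉˢ []        = []
  varsᵉˢ (t ∷ ts)  = varsᵉ t ++ varsᵉˢ ts

  varsᵗ : Pretype → List V
  varsᵗ (ty S ts) = varsᵉˢ ts

  infixl 8 _[_/_]ᵛ _[_/_]ᵉ _[_/_]ᵉˢ _[_/_]ᵗ

  _[_/_]ᵛ : ∀ {n} → V → Vec Preelement n → Vec V n → Preelement
  y [ []     / []     ]ᵛ = var y
  y [ a ∷ as / x ∷ xs ]ᵛ with y ≟ x
  ... | yes _ = a
  ... | no  _ = y [ as / xs ]ᵛ

  _[_/_]ᵉ  : ∀ {n} → Preelement → Vec Preelement n → Vec V n → Preelement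
  _[_/_]ᵉˢ : ∀ {n} → List Preelement → Vec Preelement n → Vec V n → List Preelement
  var y    [ as / xs ]ᵉ  = y [ as / xs ]ᵛ
  fun f ts [ as / xs ]ᵉ  = fun f (ts [ as / xs ]ᵉˢ)
  []       [ as / xs ]ᵉˢ = []
  (t ∷ ts) [ as / xs ]ᵉˢ = (t [ as / xs ]ᵉ) ∷ (ts [ as / xs ]ᵉˢ)

  _[_/_]ᵗ : ∀ {n} → Pretype → Vec Preelement n → Vec V n → Pretype
  ty S ts [ as / xs ]ᵗ = ty S (ts [ as / xs ]ᵉˢ)

  ----------------------------------------------------------------------
  -- Precontexts

  -- The side conditions are irrelevant, so that equality of precontexts is
  -- equality of the underlying sequences x₁ : A₁, …, xₙ : Aₙ.
  infixl 5 _▸_∶_[_,_]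

  data Precontext : Set ℓ
  ∣_∣ : Precontext → ℕ
  OV  : (Γ : Precontext) → Vec V ∣ Γ ∣

  varsᶜ : Precontext → List V
  varsᶜ Γ = toList (OV Γ)

  Fresh : Precontext → Pred V ℓ
  Fresh Γ = φ (varsᶜ Γ)

  data Precontext where
    ⟨⟩ : Precontext
    _▸_∶_[_,_] : (Γ : Precontext) (x : V) (A : Pretype) →
                 .(Fresh Γ x) → .(varsᵗ A ⊆ varsᶜ Γ) → Precontext

  ∣ ⟨⟩ ∣                    = zero
  ∣ Γ ▸ x ∶ A [ _ , _ ] ∣   = suc ∣ Γ ∣

  OV ⟨⟩                     = []
  OV (Γ ▸ x ∶ A [ _ , _ ])  = OV Γ ∷ʳ x

  fresh : Precontext → V
  fresh Γ = fr (varsᶜ Γ)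

  extend : (Γ : Precontext) (A : Pretype) → .(varsᵗ A ⊆ varsᶜ Γ) → Precontext
  extend Γ A A⊆ = Γ ▸ fresh Γ ∶ A [ fr∈φ (varsᶜ Γ) , A⊆ ]

  OVᵉ : (Γ : Precontext) → Vec Preelement ∣ Γ ∣
  OVᵉ Γ = Vec.map var (OV Γ)

  infix 4 _∶_∈ᶜ_

  data _∶_∈ᶜ_ (y : V) (B : Pretype) : Precontext → Set ℓ where
    here  : ∀ {Γ} .{x# : Fresh Γ y} .{A⊆ : varsᵗ B ⊆ varsᶜ Γ} →
            y ∶ B ∈ᶜ (Γ ▸ y ∶ B [ x# , A⊆ ])
    there : ∀ {Γ x A} .{x# : Fresh Γ x} .{A⊆ : varsᵗ A ⊆ varsᶜ Γ} →
            y ∶ B ∈ᶜ Γ → y ∶ B ∈ᶜ (Γ ▸ x ∶ A [ x# , A⊆ ])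

  TV : Precontext → List V
  TV ⟨⟩                    = []
  TV (Γ ▸ x ∶ A [ _ , _ ]) = filter (λ y → ¬? (y ∈? varsᵗ A)) (TV Γ) ++ (x ∷ [])

  _at_ : ∀ {A : Set ℓ} {n} → Vec A n → List (Fin n) → List A
  as at is = List.map (lookup as) is

  DeterminingSequence : Precontext → Set ℓ
  DeterminingSequence Γ =
    [ is ∈ List (Fin ∣ Γ ∣) ∣ Linked Fin._<_ is × TV Γ ⊆ (OV Γ at is) ]

  ----------------------------------------------------------------------
  -- Signatures

  data Predeclaration : Set ℓ where
    typeDecl : (Γ : Precontext) (S : T) (ī : DeterminingSequence Γ) →
               Predeclaration
    funDecl  : (Γ : Precontext) (f : F) (ī : DeterminingSequence Γ)
               (U : Pretype) → .(varsᵗ U ⊆ varsᶜ Γ) → Predeclaration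

  symbol : Predeclaration → T ⊎ F
  symbol (typeDecl Γ S ī)     = inj₁ S
  symbol (funDecl  Γ f ī U _) = inj₂ f

  record Presignature : Set (lsuc ℓ) where
    field
      Declared : Pred Predeclaration ℓ
      unique   : ∀ {d d′} → Declared d → Declared d′ →
                 symbol d ≡ symbol d′ → d ≡ d′

  open Presignature public

  infix 4 _context _type⦅_⦆ _∶_⦅_⦆

  data Judgement : Set ℓ where
    _context : Precontext → Judgement
    _type⦅_⦆ : Pretype → Precontext → Judgement
    _∶_⦅_⦆   : Preelement → Pretype → Precontext → Judgement

  -- The judgements abbreviated by "ā : Δ → Γ"; the last component of ā
  -- comes first.
  components : (Δ Γ : Precontext) → Vec Preelement ∣ Γ ∣ → List Judgement
  components Δ ⟨⟩                    as = []
  components Δ (Γ ▸ x ∶ A [ _ , _ ]) as =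
    (last as ∶ A [ init as / OV Γ ]ᵗ ⦅ Δ ⦆) ∷ components Δ Γ (init as)

  contextMap : (Δ Γ : Precontext) → Vec Preelement ∣ Γ ∣ → List Judgement
  contextMap Δ Γ as = (Δ context) ∷ (Γ context) ∷ components Δ Γ as

  data 𝒥 (Σ : Presignature) : Pred Judgement ℓ where
    R1 : 𝒥 Σ (⟨⟩ context)
    R2 : ∀ {Γ x A} .(x# : Fresh Γ x) .(A⊆ : varsᵗ A ⊆ varsᶜ Γ) →
         𝒥 Σ (Γ context) → 𝒥 Σ (A type⦅ Γ ⦆) →
         𝒥 Σ ((Γ ▸ x ∶ A [ x# , A⊆ ]) context)
    R3 : ∀ {Γ x A} → 𝒥 Σ (Γ context) → x ∶ A ∈ᶜ Γ → 𝒥 Σ (var x ∶ A ⦅ Γ ⦆)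
    R4 : ∀ {Γ S ī Δ as} → Declared Σ (typeDecl Γ S ī) →
         All (𝒥 Σ) (contextMap Δ Γ as) →
         𝒥 Σ (ty S (as at value ī) type⦅ Δ ⦆)
    R5 : ∀ {Γ f ī U Δ as} .{U⊆ : varsᵗ U ⊆ varsᶜ Γ} →
         Declared Σ (funDecl Γ f ī U U⊆) →
         All (𝒥 Σ) (contextMap Δ Γ as) →
         𝒥 Σ (U [ as / OV Γ ]ᵗ type⦅ Δ ⦆) →
         𝒥 Σ (fun f (as at value ī) ∶ U [ as / OV Γ ]ᵗ ⦅ Δ ⦆)

  ContextMap : Presignature → (Δ Γ : Precontext) → Vec Preelement ∣ Γ ∣ → Set ℓ
  ContextMap Σ Δ Γ as = All (𝒥 Σ) (contextMap Δ Γ as)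

  record IsSignature (Σ : Presignature) : Set ℓ where
    field
      type-ok : ∀ {Γ S ī} → Declared Σ (typeDecl Γ S ī) → 𝒥 Σ (Γ context)
      fun-ok  : ∀ {Γ f ī U} .{U⊆ : varsᵗ U ⊆ varsᶜ Γ} →
                Declared Σ (funDecl Γ f ī U U⊆) → 𝒥 Σ (U type⦅ Γ ⦆)

  ----------------------------------------------------------------------
  -- The data 𝓕

  -- The operations of 𝓕 are given by formulas on raw expressions. That
  -- their values lie in the sets of objects, morphisms, types and terms
  -- derivable from Σ needs proof: these are the obligations. Being used only
  -- irrelevantly, their proofs do not affect 𝓕.
  record WellDefined (Σ : Presignature) : Set ℓ where
    field
      id-map    : ∀ {Γ} → 𝒥 Σ (Γ context) → ContextMap Σ Γ Γ (OVᵉ Γ)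
      ∘-map     : ∀ {Θ Δ Γ as bs} → ContextMap Σ Δ Γ as → ContextMap Σ Θ Δ bs →
                  ContextMap Σ Θ Γ (Vec.map (_[ bs / OV Δ ]ᵉ) as)
      type-sub  : ∀ {Δ Γ A as} → 𝒥 Σ (A type⦅ Γ ⦆) → ContextMap Σ Δ Γ as →
                  𝒥 Σ (A [ as / OV Γ ]ᵗ type⦅ Δ ⦆)
      term-sub  : ∀ {Δ Γ A a as} → 𝒥 Σ (a ∶ A ⦅ Γ ⦆) → ContextMap Σ Δ Γ as →
                  𝒥 Σ (a [ as / OV Γ ]ᵉ ∶ A [ as / OV Γ ]ᵗ ⦅ Δ ⦆)
      type-vars : ∀ {Γ A} → 𝒥 Σ (A type⦅ Γ ⦆) → varsᵗ A ⊆ varsᶜ Γ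
      p-map     : ∀ {Γ A} .(A⊆ : varsᵗ A ⊆ varsᶜ Γ) →
                  𝒥 Σ (Γ context) → 𝒥 Σ (A type⦅ Γ ⦆) →
                  ContextMap Σ (extend Γ A A⊆) Γ (OVᵉ Γ)
      -- v_S is given the type S, but must have the type S{p(S)}.
      v-type    : ∀ {Γ A} → 𝒥 Σ (A type⦅ Γ ⦆) → A [ OVᵉ Γ / OV Γ ]ᵗ ≡ A
      v-term    : ∀ {Γ A} .(A⊆ : varsᵗ A ⊆ varsᶜ Γ) →
                  𝒥 Σ (Γ context) → 𝒥 Σ (A type⦅ Γ ⦆) →
                  𝒥 Σ (var (fresh Γ) ∶ A ⦅ extend Γ A A⊆ ⦆)
      pair-map  : ∀ {Δ Γ A as b} .(A⊆ : varsᵗ A ⊆ varsᶜ Γ) →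
                  𝒥 Σ (A type⦅ Γ ⦆) → ContextMap Σ Δ Γ as →
                  𝒥 Σ (b ∶ A [ as / OV Γ ]ᵗ ⦅ Δ ⦆) →
                  ContextMap Σ Δ (extend Γ A A⊆) (as ∷ʳ b)

  -- Refinements carry irrelevant proofs, so elements are equal as soon as
  -- the underlying expressions are. The endpoints that tag morphisms,
  -- types and terms are the indices of Hom, Ty and Tm.
  𝓕 : (Σ : Presignature) → WellDefined Σ → CwfData ℓ ℓ ℓ ℓ
  𝓕 Σ w = record
    { Ob    = [ Γ ∈ Precontext ∣ 𝒥 Σ (Γ context) ]
    ; Hom   = λ (Δ , _) (Γ , _) → [ as ∈ Vec Preelement ∣ Γ ∣ ∣ ContextMap Σ Δ Γ as ]
    ; id    = λ { {Γ , [ c ]} → OVᵉ Γ , [ id-map c ] }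
    ; _∘_   = λ { {_} {Δ , _} (ts , [ m ]) (ss , [ n ]) →
                  Vec.map (_[ ss / OV Δ ]ᵉ) ts , [ ∘-map m n ] }
    ; ⊤     = ⟨⟩ , [ R1 ]
    ; Ty    = λ (Γ , _) → [ A ∈ Pretype ∣ 𝒥 Σ (A type⦅ Γ ⦆) ]
    ; _⟪_⟫  = λ { {_} {Γ , _} (A , [ d ]) (as , [ m ]) →
                  A [ as / OV Γ ]ᵗ , [ type-sub d m ] }
    ; _▹_   = λ (Γ , [ c ]) (A , [ d ]) →
                  extend Γ A (type-vars d) , [ R2 _ _ c d ]
    ; p     = λ { {Γ , [ c ]} (A , [ d ]) → OVᵉ Γ , [ p-map _ c d ] }
    ; Tm    = λ (Γ , _) (A , _) → [ a ∈ Preelement ∣ 𝒥 Σ (a ∶ A ⦅ Γ ⦆) ]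
    ; _⟪_⟫ᵗ = λ { {_} {Γ , _} (a , [ d ]) (as , [ m ]) →
                  a [ as / OV Γ ]ᵉ , [ term-sub d m ] }
    ; v     = λ { {Γ , [ c ]} (A , [ d ]) → var (fresh Γ) ,
                  [ subst (λ B → 𝒥 Σ (var (fresh Γ) ∶ B ⦅ extend Γ A (type-vars d) ⦆))
                          (sym (v-type d)) (v-term _ c d) ] }
    ; pair  = λ { (A , [ d ]) (ss , [ m ]) (b , [ e ]) →
                  ss ∷ʳ b , [ pair-map _ d m e ] }
    }
    where open WellDefined w

{-# OPTIONS --safe #-}

-- Derivations are closed under substitution along context maps, by induction
-- on the derivation: R4 and R5 instantiate a declaration along a context map,
-- and substituting in the conclusion amounts to composing that map with the
-- given one. The equations of a cwf then reduce to equations between raw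
-- substitutions, which hold because every derivable expression only contains
-- variables of its context and the variables of a context are distinct. Under
-- the de Bruijn property the variable introduced by R2 is forced to be
-- fresh(Γ), so that each context is built by comprehension in one way only.

module Submission where

open import Defs
open import Data.Fin.Base using (Fin)
open import Data.Irrelevant as Irrelevant using (Irrelevant; [_])
open import Data.List.Base as List using (List; []; _∷_)
open import Data.List.Membership.Propositional using (_∈_; _∉_)
open import Data.List.Membership.Propositional.Properties
  using (∈-++⁺ˡ; ∈-++⁺ʳ; ∈-++⁻)
open import Data.List.Relation.Binary.Subset.Propositional using (_⊆_)
open import Data.List.Relation.Unary.All using (All; []; _∷_)
open import Data.List.Relation.Unary.Any as Any using (here; there)
open import Data.Nat.Base using (ℕ; suc)
open import Data.Product.Base using (∃; _×_; _,_; proj₁; proj₂)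
open import Data.Refinement using (_,_; value; value-injective)
open import Data.Sum.Base using ([_,_]′)
open import Data.Vec.Base as Vec
  using (Vec; []; _∷_; _∷ʳ_; init; last; lookup; toList)
open import Data.Vec.Properties
  using (init-∷ʳ; last-∷ʳ; lookup-map; map-cong; map-id; map-∘; map-∷ʳ; toList-∷ʳ)
open import Data.Vec.Relation.Unary.All as VecAll using ([]; _∷_)
open import Data.Vec.Relation.Unary.All.Properties using (lookup⁺)
open import Function.Base using (_∘_)
open import Level using (Level)
open import Relation.Binary.PropositionalEquality
  using (_≡_; refl; sym; trans; cong; cong₂; subst; subst₂; module ≡-Reasoning)
open import Relation.Nullary.Decidable using (yes; no; recompute)
open import Relation.Nullary.Negation using (contradiction; contradiction-irr)
open import Relation.Unary using (Pred)

private
  variable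
    a b ℓ : Level
    n : ℕ

-- Vectors decomposed at their last entry.

module _ {A : Set a} where

  init∷ʳlast : (xs : Vec A (suc n)) → init xs ∷ʳ last xs ≡ xs
  init∷ʳlast (x ∷ [])         = refl
  init∷ʳlast (x ∷ xs@(_ ∷ _)) = cong (x ∷_) (init∷ʳlast xs)

  All-init-last : {P : Pred A ℓ} (xs : Vec A (suc n)) →
                  VecAll.All P (init xs) → P (last xs) → VecAll.All P xs
  All-init-last (x ∷ [])         []         pl = pl ∷ []
  All-init-last (x ∷ xs@(_ ∷ _)) (px ∷ pxs) pl = px ∷ All-init-last xs pxs pl

  toList-∷ʳ⁺ˡ : ∀ {x y : A} (xs : Vec A n) →
                y ∈ toList xs → y ∈ toList (xs ∷ʳ x)
  toList-∷ʳ⁺ˡ {x = x} xs y∈xs =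
    subst (_ ∈_) (sym (toList-∷ʳ x xs)) (∈-++⁺ˡ y∈xs)

  toList-∷ʳ⁺ʳ : ∀ {x : A} (xs : Vec A n) → x ∈ toList (xs ∷ʳ x)
  toList-∷ʳ⁺ʳ {x = x} xs =
    subst (_ ∈_) (sym (toList-∷ʳ x xs)) (∈-++⁺ʳ (toList xs) (here refl))

  module _ {B : Set b} where

    init-map : (f : A → B) (xs : Vec A (suc n)) →
               init (Vec.map f xs) ≡ Vec.map f (init xs)
    init-map f (x ∷ [])         = refl
    init-map f (x ∷ xs@(_ ∷ _)) = cong (f x ∷_) (init-map f xs)

    last-map : (f : A → B) (xs : Vec A (suc n)) →
               last (Vec.map f xs) ≡ f (last xs)
    last-map f (x ∷ [])         = refl
    last-map f (x ∷ xs@(_ ∷ _)) = last-map f xs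

    map-cong-∈ : {f g : A → B} (xs : Vec A n) →
                 (∀ {x} → x ∈ toList xs → f x ≡ g x) →
                 Vec.map f xs ≡ Vec.map g xs
    map-cong-∈ []       f≗g = refl
    map-cong-∈ (x ∷ xs) f≗g =
      cong₂ _∷_ (f≗g (here refl)) (map-cong-∈ xs (f≗g ∘ there))

module _ {ℓ} (𝕍 : VariableSystem ℓ) (𝕊 : Symbols ℓ) where
  open VariableSystem 𝕍
  open Symbols 𝕊
  open Syntax 𝕍 𝕊

  private
    variable
      k m : ℕ
      xs : Vec V n
      zs : Vec V m
      ws : Vec V k
      as : Vec Preelement n
      bs : Vec Preelement m
      cs : Vec Preelement k

  -- Substitution

  -- A substitution acts through its values at the occurring variables, so agreement there suffices.
  -- Composition and congruence of substitutions are both instances.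
  sub-fusionᵉ : ∀ e → (∀ {y} → y ∈ varsᵉ e →
                       (y [ as / xs ]ᵛ) [ bs / zs ]ᵉ ≡ y [ cs / ws ]ᵛ) →
                e [ as / xs ]ᵉ [ bs / zs ]ᵉ ≡ e [ cs / ws ]ᵉ
  sub-fusionᵉˢ : ∀ ts → (∀ {y} → y ∈ varsᵉˢ ts →
                         (y [ as / xs ]ᵛ) [ bs / zs ]ᵉ ≡ y [ cs / ws ]ᵛ) →
                 ts [ as / xs ]ᵉˢ [ bs / zs ]ᵉˢ ≡ ts [ cs / ws ]ᵉˢ
  sub-fusionᵉ (var y)    eq = eq (here refl)
  sub-fusionᵉ (fun f ts) eq = cong (fun f) (sub-fusionᵉˢ ts eq)
  sub-fusionᵉˢ []        eq = refl
  sub-fusionᵉˢ (t ∷ ts)  eq =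
    cong₂ _∷_ (sub-fusionᵉ t (eq ∘ ∈-++⁺ˡ))
              (sub-fusionᵉˢ ts (eq ∘ ∈-++⁺ʳ (varsᵉ t)))

  -- A match returns the variable looked up and a miss leaves it alone.
  sub-varᵛ : (y : V) (xs : Vec V n) → y [ Vec.map var xs / xs ]ᵛ ≡ var y
  sub-varᵛ y []       = refl
  sub-varᵛ y (x ∷ xs) with y ≟ x
  ... | yes y≡x = cong var (sym y≡x)
  ... | no  _   = sub-varᵛ y xs

  sub-varᵉ  : (xs : Vec V n) → ∀ e → e [ Vec.map var xs / xs ]ᵉ ≡ e
  sub-varᵉˢ : (xs : Vec V n) → ∀ ts → ts [ Vec.map var xs / xs ]ᵉˢ ≡ ts
  sub-varᵉ  xs (var y)    = sub-varᵛ y xs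
  sub-varᵉ  xs (fun f ts) = cong (fun f) (sub-varᵉˢ xs ts)
  sub-varᵉˢ xs []         = refl
  sub-varᵉˢ xs (t ∷ ts)   = cong₂ _∷_ (sub-varᵉ xs t) (sub-varᵉˢ xs ts)

  sub-varᵗ : (xs : Vec V n) → ∀ A → A [ Vec.map var xs / xs ]ᵗ ≡ A
  sub-varᵗ xs (ty S ts) = cong (ty S) (sub-varᵉˢ xs ts)

  sub-congᵗ : ∀ A → (∀ {y} → y ∈ varsᵗ A → y [ as / xs ]ᵛ ≡ y [ bs / zs ]ᵛ) →
              A [ as / xs ]ᵗ ≡ A [ bs / zs ]ᵗ
  sub-congᵗ (ty S ts) eq = cong (ty S)
    -- Following `as / xs` by the empty substitution turns the left side into a composite, to which
    -- fusion applies.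
    (trans (sym (sub-varᵉˢ [] _))
           (sub-fusionᵉˢ ts λ y∈ts → trans (sub-varᵉ [] _) (eq y∈ts)))

  -- The scope condition matters: a variable outside `xs` survives `as` and may then be replaced by
  -- `bs`, whereas the right side leaves it alone. It is irrelevant because the scope conditions
  -- stored in precontexts are.
  sub-∘ᵛ : ∀ {y} (as : Vec Preelement n) (xs : Vec V n) → .(y ∈ toList xs) →
           (y [ as / xs ]ᵛ) [ bs / zs ]ᵉ
           ≡ y [ Vec.map (_[ bs / zs ]ᵉ) as / xs ]ᵛ
  sub-∘ᵛ []       []       y∈xs = contradiction-irr y∈xs λ ()
  sub-∘ᵛ {y = y} (a ∷ as) (x ∷ xs) y∈xs with y ≟ x
  ... | yes _   = refl
  ... | no  y≢x = sub-∘ᵛ as xs (Any.tail y≢x y∈xs)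

  sub-∘ᵉ : ∀ e → .(varsᵉ e ⊆ toList xs) →
           e [ as / xs ]ᵉ [ bs / zs ]ᵉ ≡ e [ Vec.map (_[ bs / zs ]ᵉ) as / xs ]ᵉ
  sub-∘ᵉ {xs = xs} {as = as} {bs = bs} {zs = zs} e e⊆xs =
    sub-fusionᵉ e λ y∈e → sub-∘ᵛ {bs = bs} {zs = zs} as xs (e⊆xs y∈e)

  sub-∘ᵗ : ∀ A → .(varsᵗ A ⊆ toList xs) →
           A [ as / xs ]ᵗ [ bs / zs ]ᵗ ≡ A [ Vec.map (_[ bs / zs ]ᵉ) as / xs ]ᵗ
  sub-∘ᵗ {xs = xs} {as = as} {bs = bs} {zs = zs} (ty S ts) A⊆xs =
    cong (ty S) (sub-fusionᵉˢ ts λ y∈ts →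
      sub-∘ᵛ {bs = bs} {zs = zs} as xs (A⊆xs y∈ts))

  map-sub-∘ : (cs : Vec Preelement k) →
              .(VecAll.All (λ c → varsᵉ c ⊆ toList xs) cs) →
              Vec.map (_[ bs / zs ]ᵉ) (Vec.map (_[ as / xs ]ᵉ) cs)
              ≡ Vec.map (_[ Vec.map (_[ bs / zs ]ᵉ) as / xs ]ᵉ) cs
  map-sub-∘ []       cs⊆xs = refl
  map-sub-∘ (c ∷ cs) cs⊆xs =
    cong₂ _∷_ (sub-∘ᵉ c (VecAll.head cs⊆xs)) (map-sub-∘ cs (VecAll.tail cs⊆xs))

  at-sub : ∀ (as : Vec Preelement n) (is : List (Fin n)) →
           (as at is) [ bs / zs ]ᵉˢ ≡ Vec.map (_[ bs / zs ]ᵉ) as at is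
  at-sub as []       = refl
  at-sub as (i ∷ is) =
    cong₂ _∷_ (sym (lookup-map i (_[ _ / _ ]ᵉ) as)) (at-sub as is)

  -- Lookup stops at the first match, which lies in `xs`, so the final pair is never reached.
  sub-initᵛ : ∀ {y x} (as : Vec Preelement (suc n)) (xs : Vec V n) →
              .(y ∈ toList xs) → y [ as / xs ∷ʳ x ]ᵛ ≡ y [ init as / xs ]ᵛ
  sub-initᵛ (a ∷ []) [] y∈xs = contradiction-irr y∈xs λ ()
  sub-initᵛ {y = y} (a ∷ as@(_ ∷ _)) (x ∷ xs) y∈xs with y ≟ x
  ... | yes _   = refl
  ... | no  y≢x = sub-initᵛ as xs (Any.tail y≢x y∈xs)

  sub-initᵗ : ∀ {x} (as : Vec Preelement (suc n)) (xs : Vec V n) A →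
              .(varsᵗ A ⊆ toList xs) →
              A [ as / xs ∷ʳ x ]ᵗ ≡ A [ init as / xs ]ᵗ
  sub-initᵗ as xs A A⊆xs = sub-congᵗ A λ y∈A → sub-initᵛ as xs (A⊆xs y∈A)

  map-sub-init : ∀ {x} (as : Vec Preelement (suc n)) (xs : Vec V n) →
                 Vec.map (_[ as / xs ∷ʳ x ]ᵛ) xs
                 ≡ Vec.map (_[ init as / xs ]ᵛ) xs
  map-sub-init as xs = map-cong-∈ xs λ y∈xs → sub-initᵛ as xs y∈xs

  -- Freshness excludes every earlier match, so lookup reaches the final pair.
  sub-lastᵛ : ∀ {x} (as : Vec Preelement (suc n)) (xs : Vec V n) →
              .(x ∉ toList xs) → x [ as / xs ∷ʳ x ]ᵛ ≡ last as
  sub-lastᵛ {x = x} (a ∷ []) [] x∉xs with x ≟ x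
  ... | yes _   = refl
  ... | no  x≢x = contradiction refl x≢x
  sub-lastᵛ {x = x} (a ∷ as@(_ ∷ _)) (y ∷ xs) x∉xs with x ≟ y
  ... | yes x≡y = contradiction-irr x∉xs λ x∉xs → x∉xs (here x≡y)
  ... | no  _   = sub-lastᵛ as xs (x∉xs ∘ there)

  -- This is where distinctness of the variables of a context enters: each lookup finds exactly its
  -- own component. It yields the left identity law.
  map-sub-OV : ∀ Γ (as : Vec Preelement ∣ Γ ∣) →
               Vec.map (_[ as / OV Γ ]ᵛ) (OV Γ) ≡ as
  map-sub-OV ⟨⟩                     [] = refl
  map-sub-OV (Γ ▸ x ∶ A [ x# , A⊆ ]) as = begin
    Vec.map (_[ as / OV Γ ∷ʳ x ]ᵛ) (OV Γ ∷ʳ x)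
      ≡⟨ map-∷ʳ _ x (OV Γ) ⟩
    Vec.map (_[ as / OV Γ ∷ʳ x ]ᵛ) (OV Γ) ∷ʳ (x [ as / OV Γ ∷ʳ x ]ᵛ)
      ≡⟨ cong₂ _∷ʳ_ (trans (map-sub-init as (OV Γ)) (map-sub-OV Γ (init as)))
                    (sub-lastᵛ as (OV Γ) (φ-fresh x#)) ⟩
    init as ∷ʳ last as
      ≡⟨ init∷ʳlast as ⟩
    as ∎
    where open ≡-Reasoning

  map-sub-OVᵉ : ∀ Γ (as : Vec Preelement ∣ Γ ∣) →
                Vec.map (_[ as / OV Γ ]ᵉ) (OVᵉ Γ) ≡ as
  map-sub-OVᵉ Γ as =
    trans (sym (map-∘ (_[ as / OV Γ ]ᵉ) var (OV Γ))) (map-sub-OV Γ as)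

  -- Composing with the projection `p` drops the last component of a map.
  map-sub-init-OVᵉ : ∀ {x} Γ (as : Vec Preelement (suc ∣ Γ ∣)) →
                     Vec.map (_[ as / OV Γ ∷ʳ x ]ᵉ) (OVᵉ Γ) ≡ init as
  map-sub-init-OVᵉ {x} Γ as =
    trans (sym (map-∘ (_[ as / OV Γ ∷ʳ x ]ᵉ) var (OV Γ)))
          (trans (map-sub-init as (OV Γ)) (map-sub-OV Γ (init as)))

  sub-fresh : ∀ Γ (as : Vec Preelement (suc ∣ Γ ∣)) →
              fresh Γ [ as / OV Γ ∷ʳ fresh Γ ]ᵛ ≡ last as
  sub-fresh Γ as = sub-lastᵛ as (OV Γ) (φ-fresh (fr∈φ (varsᶜ Γ)))

  -- Derivations

  ∈ᶜ⇒∈ : ∀ {Γ x A} → x ∶ A ∈ᶜ Γ → x ∈ varsᶜ Γ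
  ∈ᶜ⇒∈ (here {Γ})      = toList-∷ʳ⁺ʳ (OV Γ)
  ∈ᶜ⇒∈ (there {Γ} x∈Γ) = toList-∷ʳ⁺ˡ (OV Γ) (∈ᶜ⇒∈ x∈Γ)

  -- The inclusion comes from an irrelevant field of the precontext, so it can be returned only in a
  -- box.
  ∈ᶜ⇒⊆ : ∀ {Γ x A} → x ∶ A ∈ᶜ Γ → Irrelevant (varsᵗ A ⊆ varsᶜ Γ)
  ∈ᶜ⇒⊆ (here {Γ} {A⊆ = A⊆}) = [ (λ y∈A → toList-∷ʳ⁺ˡ (OV Γ) (A⊆ y∈A)) ]
  ∈ᶜ⇒⊆ (there {Γ} x∈Γ)      =
    Irrelevant.map (λ A⊆ y∈A → toList-∷ʳ⁺ˡ (OV Γ) (A⊆ y∈A)) (∈ᶜ⇒⊆ x∈Γ)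

  module _ {Σ : Presignature} where

    -- Scoping of derivable judgements.

    Components : (Δ Γ : Precontext) → Vec Preelement ∣ Γ ∣ → Set ℓ
    Components Δ Γ as = All (𝒥 Σ) (components Δ Γ as)

    Scoped : Precontext → Preelement → Set ℓ
    Scoped Δ a = varsᵉ a ⊆ varsᶜ Δ

    at-vars : ∀ {Δ} {as : Vec Preelement n} → VecAll.All (Scoped Δ) as →
              ∀ is → varsᵉˢ (as at is) ⊆ varsᶜ Δ
    at-vars {as = as} as⊆ (i ∷ is) y∈ =
      [ lookup⁺ as⊆ i , at-vars as⊆ is ]′ (∈-++⁻ (varsᵉ (lookup as i)) y∈)

    -- The arguments in a derived expression are selected from a context map, whose components are
    -- scoped by induction on their derivations. This supplies scope conditions for the cwf
    -- equations.
    term-vars       : ∀ {Δ A a} → 𝒥 Σ (a ∶ A ⦅ Δ ⦆) → Scoped Δ a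
    components-vars : ∀ {Δ} Γ {as} → Components Δ Γ as →
                      VecAll.All (Scoped Δ) as
    term-vars (R3 _ x∈Γ) (here refl)             = ∈ᶜ⇒∈ x∈Γ
    term-vars (R5 {Γ} {ī = ī} _ (_ ∷ _ ∷ cs) _)  =
      at-vars (components-vars Γ cs) (value ī)
    components-vars ⟨⟩                    {[]} []       = []
    components-vars (Γ ▸ x ∶ A [ _ , _ ]) {as} (d ∷ ds) =
      All-init-last as (components-vars Γ ds) (term-vars d)

    type-vars : ∀ {Δ A} → 𝒥 Σ (A type⦅ Δ ⦆) → varsᵗ A ⊆ varsᶜ Δ
    type-vars (R4 {Γ} {ī = ī} _ (_ ∷ _ ∷ cs)) =
      at-vars (components-vars Γ cs) (value ī)

    map-vars : ∀ {Δ Γ as} → ContextMap Σ Δ Γ as → VecAll.All (Scoped Δ) as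
    map-vars {Γ = Γ} (_ ∷ _ ∷ cs) = components-vars Γ cs

    -- Closure of derivations under substitution.

    var-sub : ∀ {Δ Γ x A as} → x ∶ A ∈ᶜ Γ → Components Δ Γ as →
              𝒥 Σ (x [ as / OV Γ ]ᵛ ∶ A [ as / OV Γ ]ᵗ ⦅ Δ ⦆)
    var-sub {Δ} {A = A} {as} (here {Γ} {x#} {A⊆}) (d ∷ _) =
      -- A component is typed by means of the earlier components only; `A` contains no later
      -- variable, so the full substitution gives the same type.
      subst₂ (λ a B → 𝒥 Σ (a ∶ B ⦅ Δ ⦆))
             (sym (sub-lastᵛ as (OV Γ) (φ-fresh x#)))
             (sym (sub-initᵗ as (OV Γ) A A⊆)) d
    var-sub {Δ} {A = A} {as} (there {Γ} x∈Γ) (_ ∷ ds) with ∈ᶜ⇒⊆ x∈Γ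
    ... | [ A⊆ ] =
      subst₂ (λ a B → 𝒥 Σ (a ∶ B ⦅ Δ ⦆))
             (sym (sub-initᵛ as (OV Γ) (∈ᶜ⇒∈ x∈Γ)))
             (sym (sub-initᵗ as (OV Γ) A A⊆)) (var-sub x∈Γ ds)

    type-sub       : ∀ {Θ Δ A bs} → 𝒥 Σ (A type⦅ Δ ⦆) → ContextMap Σ Θ Δ bs →
                     𝒥 Σ (A [ bs / OV Δ ]ᵗ type⦅ Θ ⦆)
    term-sub       : ∀ {Θ Δ A a bs} → 𝒥 Σ (a ∶ A ⦅ Δ ⦆) → ContextMap Σ Θ Δ bs →
                     𝒥 Σ (a [ bs / OV Δ ]ᵉ ∶ A [ bs / OV Δ ]ᵗ ⦅ Θ ⦆)
    components-sub : ∀ {Θ Δ} Γ {as bs} → Components Δ Γ as →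
                     ContextMap Σ Θ Δ bs →
                     Components Θ Γ (Vec.map (_[ bs / OV Δ ]ᵉ) as)
    type-sub {Θ} (R4 {Γ} {S} {ī} {as = as} decl (_ ∷ c ∷ cs)) m@(c′ ∷ _) =
      subst (λ ts → 𝒥 Σ (ty S ts type⦅ Θ ⦆)) (sym (at-sub as (value ī)))
            (R4 decl (c′ ∷ c ∷ components-sub Γ cs m))
    term-sub (R3 _ x∈Δ) (_ ∷ _ ∷ cs) = var-sub x∈Δ cs
    term-sub {Θ} (R5 {Γ} {f} {ī} {U} {as = as} {U⊆} decl (_ ∷ c ∷ cs) d) m@(c′ ∷ _) =
      subst₂ (λ ts B → 𝒥 Σ (fun f ts ∶ B ⦅ Θ ⦆))
             (sym (at-sub as (value ī))) (sym U-sub)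
             -- The last premise of `R5` is a subderivation, so the induction applies to it
             -- directly; `U-sub` rewrites the result as an instance of `U` along the composite map.
             (R5 decl (c′ ∷ c ∷ components-sub Γ cs m)
                 (subst (λ B → 𝒥 Σ (B type⦅ Θ ⦆)) U-sub (type-sub d m)))
      where U-sub = sub-∘ᵗ {as = as} U U⊆
    components-sub ⟨⟩ [] m = []
    components-sub {Θ} {Δ} (Γ ▸ x ∶ A [ _ , A⊆ ]) {as} {bs} (d ∷ ds) m
      rewrite init-map (_[ bs / OV Δ ]ᵉ) as | last-map (_[ bs / OV Δ ]ᵉ) as =
      subst (λ B → 𝒥 Σ (_ ∶ B ⦅ Θ ⦆)) (sub-∘ᵗ A A⊆) (term-sub d m)
      ∷ components-sub Γ ds m

    -- Separating source from target lets one induction serve both the identity, with `Δ` equal to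
    -- `Γ`, and the projection, with `Δ` an extension of `Γ`.
    inclusion : ∀ {Δ} Γ → 𝒥 Σ (Δ context) →
                (∀ {x A} → x ∶ A ∈ᶜ Γ → x ∶ A ∈ᶜ Δ) → Components Δ Γ (OVᵉ Γ)
    inclusion ⟨⟩ c Γ⊆Δ = []
    inclusion {Δ} (Γ ▸ x ∶ A [ _ , _ ]) c Γ⊆Δ
      rewrite init-map var (OV Γ ∷ʳ x) | last-map var (OV Γ ∷ʳ x)
            | init-∷ʳ x (OV Γ) | last-∷ʳ x (OV Γ) =
      subst (λ B → 𝒥 Σ (var x ∶ B ⦅ Δ ⦆)) (sym (sub-varᵗ (OV Γ) A))
            (R3 c (Γ⊆Δ here))
      ∷ inclusion Γ c (Γ⊆Δ ∘ there)

    -- Well-definedness of the operations.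

    wellDefined : WellDefined Σ
    wellDefined = record
      { id-map    = λ {Γ} c → c ∷ c ∷ inclusion Γ c λ x∈Γ → x∈Γ
      ; ∘-map     = λ { {Γ = Γ} (_ ∷ c ∷ cs) m@(c′ ∷ _) →
                        c′ ∷ c ∷ components-sub Γ cs m }
      ; type-sub  = type-sub
      ; term-sub  = term-sub
      ; type-vars = type-vars
      ; p-map     = λ {Γ} A⊆ c d → let c′ = R2 _ A⊆ c d in
                    c′ ∷ c ∷ inclusion Γ c′ there
      ; v-type    = λ {Γ} {A} _ → sub-varᵗ (OV Γ) A
      ; v-term    = λ A⊆ c d → R3 (R2 _ A⊆ c d) here
      ; pair-map  = pair-map
      }
      where
      pair-map : ∀ {Δ Γ A as b} .(A⊆ : varsᵗ A ⊆ varsᶜ Γ) →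
                 𝒥 Σ (A type⦅ Γ ⦆) → ContextMap Σ Δ Γ as →
                 𝒥 Σ (b ∶ A [ as / OV Γ ]ᵗ ⦅ Δ ⦆) →
                 ContextMap Σ Δ (extend Γ A A⊆) (as ∷ʳ b)
      pair-map {Δ} {Γ} {A} {as} {b} A⊆ d (c′ ∷ c ∷ cs) e =
        c′ ∷ R2 _ A⊆ c d
        ∷ subst₂ (λ b as → 𝒥 Σ (b ∶ A [ as / OV Γ ]ᵗ ⦅ Δ ⦆))
                 (sym (last-∷ʳ b as)) (sym (init-∷ʳ b as)) e
        ∷ subst (Components Δ Γ) (sym (init-∷ʳ b as)) cs

    -- Equations of a category with families.

    open CwfData (𝓕 Σ wellDefined) hiding (_∘_)
    private module 𝓕Σ = CwfData (𝓕 Σ wellDefined)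

    -- Terms of all types are refinements of the same raw expressions, so transport changes only the
    -- irrelevant proof. Every transported cwf equation thereby becomes one between raw expressions.
    value-subst : ∀ {Γ} {A B : Ty Γ} (A≡B : A ≡ B) (a : Tm Γ A) →
                  value (subst (Tm Γ) A≡B a) ≡ value a
    value-subst refl a = refl

    Ty-id : ∀ {Γ} (A : Ty Γ) → _⟪_⟫ {Γ} {Γ} A (id {Γ}) ≡ A
    Ty-id {Γ} A = value-injective (sub-varᵗ (OV (value Γ)) (value A))

    Ty-∘ : ∀ {Θ Δ Γ} (A : Ty Γ) (f : Hom Δ Γ) (g : Hom Θ Δ) →
           _⟪_⟫ {Θ} {Γ} A (𝓕Σ._∘_ {Θ} {Δ} {Γ} f g)
           ≡ _⟪_⟫ {Θ} {Δ} (_⟪_⟫ {Δ} {Γ} A f) g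
    Ty-∘ (A , [ d ]) _ _ = value-injective (sym (sub-∘ᵗ A (type-vars d)))

    p-pair : ∀ {Δ Γ} (A : Ty Γ) (f : Hom Δ Γ) (a : Tm Δ (_⟪_⟫ {Δ} {Γ} A f)) →
             𝓕Σ._∘_ {Δ} {Γ ▹ A} {Γ} (p {Γ} A) (pair {Δ} {Γ} A f a) ≡ f
    p-pair {Γ = Γ} _ (as , _) (a , _) = value-injective
      (trans (map-sub-init-OVᵉ (value Γ) (as ∷ʳ a)) (init-∷ʳ a as))

    isCwf : IsCwf (𝓕 Σ wellDefined)
    isCwf = record
      { identityˡ = λ { {Γ = Γ} (as , _) → value-injective
          (map-sub-OVᵉ (value Γ) as) }
      ; identityʳ = λ { {Δ = Δ} (as , _) → value-injective
          (trans (map-cong (sub-varᵉ (OV (value Δ))) as) (map-id as)) }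
      ; assoc     = λ { (as , [ m ]) _ _ → value-injective
          (map-sub-∘ as (map-vars m)) }
      ; terminal  = λ { (Γ , [ c ]) → ([] , [ c ∷ R1 ∷ [] ]) ,
          λ { ([] , _) → refl } }
      ; Ty-id     = λ {Γ} → Ty-id {Γ}
      ; Ty-∘      = λ {Θ} {Δ} {Γ} → Ty-∘ {Θ} {Δ} {Γ}
      ; Tm-id     = λ { {Γ} {A} (a , _) → value-injective
          (trans (value-subst {Γ} (Ty-id {Γ} A) _)
                 (sub-varᵉ (OV (value Γ)) a)) }
      ; Tm-∘      = λ { {Θ} {Δ} {Γ} {A} (a , [ d ]) f g → value-injective
          (trans (value-subst {Θ} (Ty-∘ {Θ} {Δ} {Γ} A f g) _)
                 (sym (sub-∘ᵉ a (term-vars d)))) }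
      ; p-pair    = λ {Δ} {Γ} → p-pair {Δ} {Γ}
      ; v-pair    = λ { {Δ} {Γ} A f@(as , _) t@(a , _) → value-injective
          (trans (value-subst {Δ}
                   (trans (sym (Ty-∘ {Δ} {Γ ▹ A} {Γ} A (p {Γ} A)
                                     (pair {Δ} {Γ} A f t)))
                          (cong (_⟪_⟫ {Δ} {Γ} A) (p-pair {Δ} {Γ} A f t))) _)
                 (trans (sub-fresh (value Γ) (as ∷ʳ a)) (last-∷ʳ a as))) }
      ; pair-η    = λ { {Δ} {Γ} A h@(as , _) → value-injective
          (trans (cong₂ _∷ʳ_
                   (map-sub-init-OVᵉ (value Γ) as)
                   (trans (value-subst {Δ}
                            (sym (Ty-∘ {Δ} {Γ ▹ A} {Γ} A (p {Γ} A) h)) _)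
                          (sub-fresh (value Γ) as)))
                 (init∷ʳlast as)) }
      ; pair-∘    = λ { {Θ} {Δ} {Γ} A f@(as , _) (a , _) g@(bs , _) →
          value-injective
          (trans (map-∷ʳ (_[ bs / OV (value Δ) ]ᵉ) a as)
                 (cong (Vec.map (_[ bs / OV (value Δ) ]ᵉ) as ∷ʳ_)
                       (sym (value-subst {Θ}
                              (sym (Ty-∘ {Θ} {Δ} {Γ} A f g)) _)))) }
      }

    -- Contextuality.

    R2⁻¹ : ∀ {Γ x A} .{x# : Fresh Γ x} .{A⊆ : varsᵗ A ⊆ varsᶜ Γ} →
           𝒥 Σ ((Γ ▸ x ∶ A [ x# , A⊆ ]) context) →
           𝒥 Σ (Γ context) × 𝒥 Σ (A type⦅ Γ ⦆)
    R2⁻¹ (R2 _ _ c d) = c , d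

    -- With general endpoints the equation can be matched against `refl`; in `object-injective` the
    -- endpoints are computed by `object`.
    ▸-injective : ∀ {Γ Δ x y A B} .{x# : Fresh Γ x} .{y# : Fresh Δ y}
                  .{A⊆ : varsᵗ A ⊆ varsᶜ Γ} .{B⊆ : varsᵗ B ⊆ varsᶜ Δ} →
                  _≡_ {A = Precontext} (Γ ▸ x ∶ A [ x# , A⊆ ])
                                       (Δ ▸ y ∶ B [ y# , B⊆ ]) →
                  Γ ≡ Δ × A ≡ B
    ▸-injective refl = refl , refl

    object-injective : ∀ {As Bs : TypeSequence (𝓕 Σ wellDefined)} →
                       object _ As ≡ object _ Bs → As ≡ Bs
    object-injective {ε}       {ε}       eq = refl
    object-injective {As ▸▸ A} {Bs ▸▸ B} eq with ▸-injective (cong value eq)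
    ... | Γ≡Δ , A≡B with object-injective {As} {Bs} (value-injective Γ≡Δ)
    -- Only once the prefixes are identified are `A` and `B` types over the same object.
    ... | refl = cong (As ▸▸_) (value-injective A≡B)

    module _ (deBruijn : DeBruijn 𝕍) where

      extend-fresh : ∀ {Γ x A} .(x# : Fresh Γ x) .(A⊆ : varsᵗ A ⊆ varsᶜ Γ) →
                     (Γ ▸ x ∶ A [ x# , A⊆ ]) ≡ extend Γ A A⊆
      extend-fresh {Γ} {x} x# A⊆
        -- The de Bruijn property equates `x` with `fresh Γ`, but only irrelevantly, since `x#` is
        -- irrelevant; decidable equality on variables recovers a usable equation.
        with recompute (fresh Γ ≟ x) (proj₁ (deBruijn (varsᶜ Γ)) x#)
      ... | refl = refl

      -- The recursion follows the precontext because an object carries its derivation only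
      -- irrelevantly; inverting `R2` within irrelevant positions keeps every prefix a context.
      sequence : ∀ Γ → .(𝒥 Σ (Γ context)) →
                 ∃ λ (As : TypeSequence (𝓕 Σ wellDefined)) →
                 Γ ≡ value (object _ As)
      sequence ⟨⟩ c = ε , refl
      sequence (Γ ▸ x ∶ A [ x# , A⊆ ]) c with sequence Γ (proj₁ (R2⁻¹ c))
      ... | As , refl = As ▸▸ (A , [ proj₂ (R2⁻¹ c) ]) , extend-fresh x# A⊆

      isContextual : IsContextual (𝓕 Σ wellDefined)
      isContextual (Γ , [ c ]) =
        let As , eq = sequence Γ c in
        As , value-injective eq ,
        λ eq′ → object-injective (trans (sym (value-injective eq)) eq′)

mainTheorem12 : ∀ {ℓ} (𝕍 : VariableSystem ℓ) (𝕊 : Symbols ℓ) →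
    let open Syntax 𝕍 𝕊 in
    (Σ : Presignature) → IsSignature Σ →
    ∃ λ (w : WellDefined Σ) →
    IsCwf (𝓕 Σ w) × (DeBruijn 𝕍 → IsContextual (𝓕 Σ w))
mainTheorem12 𝕍 𝕊 Σ _ =
  wellDefined 𝕍 𝕊 , isCwf 𝕍 𝕊 , isContextual 𝕍 𝕊
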